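{- For every integer $n\geq 3$, writing $f_q(n)$ for the total number of occurrences of the pattern $q$ in all permutations of $S_n(132,312)$, we have $$f_{123}(n)=f_{321}(n)=\binom{n}{3}2^{n-3},$$ $$f_{213}(n)=f_{231}(n)=\binom{n}{3}2^{n-3}.$$
   Context: $S_n$ is the set of permutations of $\{1,\dots,n\}$ written in one-line notation $\sigma=\sigma_1\sigma_2\cdots\sigma_n$. For $q\in S_k$, an occurrence of the pattern $q$ in $\sigma\in S_n$ is a choice of indices $i_1<i_2<\cdots<i_k$ in $\{1,\dots,n\}$ such that for all $1\le j,l\le k$, $q_j<q_l$ if and only if $\sigma_{i_j}<\sigma_{i_l}$. Let $f_q(\sigma)$ be the number of occurrences of $q$ in $\sigma$; $\sigma$ avoids $q$ if $f_q(\sigma)=0$. $S_n(132,312)$ is the set of permutations in $S_n$ avoiding both $132$ and $312$, and $f_q(n)=\sum_{\sigma\in S_n(132,312)}f_q(\sigma)$. -}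

module Defs where

open import Data.Fin.Base using (Fin; _<_)
open import Data.Fin.Patterns using (0F; 1F; 2F)
open import Data.Fin.Properties using (_≟_; _<?_; all?)
open import Data.List.Base as List
  using (List; allFin; cartesianProductWith; filter; length)
open import Data.Nat.Base using (ℕ; zero; suc)
import Data.Nat.Properties as ℕ
open import Data.Nat.ListAction using (sum)
open import Data.Product.Base using (_×_; _,_)
open import Data.Vec.Base using (Vec; []; _∷_; lookup)
open import Data.Vec.Relation.Unary.AllPairs using (allPairs?)
open import Data.Vec.Relation.Unary.Unique.Propositional using (Unique)
open import Function.Bundles using (_⇔_; mk⇔; Equivalence)
open import Relation.Binary.PropositionalEquality.Core using (_≡_)
open import Relation.Nullary.Decidable
  using (Dec; ¬?; _×-dec_; _→-dec_; map′)
open import Relation.Unary using (Decidable)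

-- One-line notation: σ₁σ₂⋯σₙ is a vector of length n.  Positions and
-- values are shifted from {1,…,n} to Fin n; a word in Word n n is a
-- permutation exactly when its n entries are pairwise distinct.

Word : ℕ → ℕ → Set
Word n k = Vec (Fin n) k

IsPermutation : ∀ {n} → Word n n → Set
IsPermutation = Unique

isPermutation? : ∀ {n} → Decidable (IsPermutation {n})
isPermutation? = allPairs? (λ x y → ¬? (x ≟ y))

words : ∀ n k → List (Word n k)
words n zero    = List.[ [] ]
words n (suc k) = cartesianProductWith _∷_ (allFin n) (words n k)

S : ∀ n → List (Word n n)
S n = filter isPermutation? (words n n)

Increasing : ∀ {n k} → Word n k → Set
Increasing is = ∀ j l → j < l → lookup is j < lookup is l

OrderIsomorphicAt : ∀ {n k} → Word k k → Word n n → Word n k → Set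
OrderIsomorphicAt q σ is =
  ∀ j l → lookup q j < lookup q l ⇔ lookup σ (lookup is j) < lookup σ (lookup is l)

-- The vector `is` holds the chosen indices i₁ < i₂ < ⋯ < iₖ.
IsOccurrence : ∀ {n k} → Word k k → Word n n → Word n k → Set
IsOccurrence q σ is = Increasing is × OrderIsomorphicAt q σ is

_⇔-dec_ : ∀ {A B : Set} → Dec A → Dec B → Dec (A ⇔ B)
a? ⇔-dec b? = map′ (λ (f , g) → mk⇔ f g) (λ e → Equivalence.to e , Equivalence.from e)
  ((a? →-dec b?) ×-dec (b? →-dec a?))

isOccurrence? : ∀ {n k} (q : Word k k) (σ : Word n n) → Decidable (IsOccurrence q σ)
isOccurrence? q σ is =
  all? (λ j → all? (λ l → (j <? l) →-dec (lookup is j <? lookup is l)))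
  ×-dec
  all? (λ j → all? (λ l →
    (lookup q j <? lookup q l)
      ⇔-dec (lookup σ (lookup is j) <? lookup σ (lookup is l))))

occurrences : ∀ {n k} → Word k k → Word n n → ℕ
occurrences {n} {k} q σ = length (filter (isOccurrence? q σ) (words n k))

Avoids : ∀ {n k} → Word k k → Word n n → Set
Avoids q σ = occurrences q σ ≡ 0

avoids? : ∀ {n k} (q : Word k k) → Decidable (Avoids {n} q)
avoids? q σ = occurrences q σ ℕ.≟ 0

-- The patterns 123, 132, …, written with entries shifted down by one.
p123 p132 p213 p231 p312 p321 : Word 3 3
p123 = 0F ∷ 1F ∷ 2F ∷ []
p132 = 0F ∷ 2F ∷ 1F ∷ []
p213 = 1F ∷ 0F ∷ 2F ∷ []
p231 = 1F ∷ 2F ∷ 0F ∷ []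
p312 = 2F ∷ 0F ∷ 1F ∷ []
p321 = 2F ∷ 1F ∷ 0F ∷ []

S[132,312] : ∀ n → List (Word n n)
S[132,312] n = filter (λ σ → avoids? p132 σ ×-dec avoids? p312 σ) (S n)

f : ∀ {k} → Word k k → ℕ → ℕ
f q n = sum (List.map (occurrences q) (S[132,312] n))

{-# OPTIONS --safe #-}

-- A permutation avoids 132 and 312 exactly when no entry lies between two earlier ones, that
-- is, when every entry after the first lies above all earlier entries or below all of them.
-- Recording which of the two happens gives a bijection with the sign vectors of length n - 1;
-- its inverse is computed from the right, since the first entry of such a permutation is always
-- adjacent in value to the second.  The patterns 123, 213, 231, 321 are themselves given by
-- sign vectors, and such a pattern with signs p occurs at positions i₀ < i₁ < ⋯ if and only if
-- the signs at i₁, i₂, … are p.  Hence a pattern of length k occurs at each k-subset of positions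
-- in 2^(n - k) of the permutations.

module Submission where

open import Defs
open import Algebra.Properties.CommutativeSemigroup using (x∙yz≈y∙xz)
open import Data.Bool.Base using (Bool; true; false)
import Data.Bool.Properties as Bool
open import Data.Fin.Base as Fin
  using (Fin; zero; suc; toℕ; inject₁; fromℕ<; punchIn; punchOut; _<_)
open import Data.Fin.Patterns using (0F; 1F; 2F)
open import Data.Fin.Properties as Fin
  using (<-cmp; <-irrefl; toℕ-injective; toℕ-fromℕ<; toℕ-inject₁; toℕ<n; suc-injective
    ; punchIn-injective; punchInᵢ≢i; punchIn-cancel-≤; punchIn-punchOut)
open import Data.List.Base as List using (List; []; _∷_; _++_; filter; length)
open import Data.List.Properties
  using (length-++; length-map; filter-++; filter-≐; filter-none; map-cong)
open import Data.List.Membership.Propositional using (_∈_)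
open import Data.List.Membership.Propositional.Properties
  using (∈-map⁺; ∈-map⁻; ∈-++⁺ˡ; ∈-++⁺ʳ; ∈-++⁻; ∈-filter⁺; ∈-filter⁻; ∈-allFin
    ; ∈-cartesianProductWith⁺)
open import Data.List.Membership.Propositional.Properties.WithK using (unique∧set⇒bag)
open import Data.List.Relation.Binary.BagAndSetEquality using (∼bag⇒↭)
open import Data.List.Relation.Binary.Permutation.Propositional using (_↭_)
open import Data.List.Relation.Binary.Permutation.Propositional.Properties using (↭-length; map⁺)
import Data.List.Relation.Unary.All as ListAll
open import Data.List.Relation.Unary.Any using (here)
open import Data.List.Relation.Unary.AllPairs using ([]; _∷_)
import Data.List.Properties as List
import Data.List.Relation.Unary.Unique.Propositional as List
import Data.List.Relation.Unary.Unique.Propositional.Properties as List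
open import Data.Nat.Base
  using (ℕ; zero; suc; _+_; _≤_; z≤n; s≤s; z<s; s<s; s≤s⁻¹; s<s⁻¹; _*_; _^_; _∸_)
open import Data.Nat.Combinatorics using (_C_; nCk+nC[k+1]≡[n+1]C[k+1])
open import Data.Nat.ListAction using (sum)
open import Data.Nat.ListAction.Properties using (sum-↭)
import Data.Nat.Properties as ℕ
open import Data.Product.Base using (∃; _×_; _,_; proj₂)
open import Data.Sum.Base using (inj₁; inj₂)
open import Data.Vec.Base as Vec using (Vec; []; _∷_; tail; lookup)
open import Data.Vec.Properties as Vec
  using (map-∘; lookup-map; ∷-injective; ∷-injectiveˡ; ∷-injectiveʳ; ≡-dec; tabulate-cong
    ; tabulate∘lookup)
open import Data.Vec.Relation.Unary.All as All using (All; []; _∷_)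
import Data.Vec.Relation.Unary.All.Properties as All
open import Data.Vec.Relation.Unary.AllPairs using ([]; _∷_)
open import Data.Vec.Relation.Unary.Unique.Propositional using (Unique)
import Data.Vec.Relation.Unary.Unique.Propositional.Properties as Unique
open import Function.Base using (_∘_)
open import Function.Bundles using (_⇔_; mk⇔; Equivalence)
open import Level using (Level)
open import Relation.Binary.Definitions using (tri<; tri≈; tri>)
open import Relation.Binary.PropositionalEquality.Core
  using (_≡_; _≢_; refl; sym; trans; cong; cong₂; subst; subst₂)
open import Relation.Binary.PropositionalEquality.Properties using (module ≡-Reasoning)
open import Relation.Nullary.Decidable.Core using (Dec; yes; no; _×-dec_; does; from-yes)
open import Relation.Nullary.Negation.Core using (¬_; contradiction)
open import Relation.Unary using (Pred; Decidable)

open Equivalence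

private
  variable
    a p : Level
    A B : Set a
    k m n : ℕ

-- Counting in lists.

length-filter-map : {P : Pred B p} (P? : Decidable P) (g : A → B) (xs : List A) →
  length (filter P? (List.map g xs)) ≡ length (filter (P? ∘ g) xs)
length-filter-map P? g []       = refl
length-filter-map P? g (x ∷ xs) with does (P? (g x))
... | true  = cong suc (length-filter-map P? g xs)
... | false = length-filter-map P? g xs

sum-map-constant : (g : A → ℕ) (c : ℕ) (xs : List A) → (∀ {x} → x ∈ xs → g x ≡ c) →
  sum (List.map g xs) ≡ length xs * c
sum-map-constant g c []       _  = refl
sum-map-constant g c (x ∷ xs) eq =
  cong₂ _+_ (eq (here refl)) (sum-map-constant g c xs (eq ∘ ∈-++⁺ʳ (x ∷ [])))

module _ {R : A → B → Set} (R? : ∀ x y → Dec (R x y)) where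

  private
    row : A → List B → ℕ
    row x ys = length (filter (R? x) ys)

    column : List A → B → ℕ
    column xs y = length (filter (λ x → R? x y) xs)

  -- Adding the row `x` raises the column count of `y` by one exactly when `R x y` holds, and
  -- `row x ys` counts these `y`.
  double-counting-∷ : ∀ x xs ys →
    row x ys + sum (List.map (column xs) ys) ≡ sum (List.map (column (x ∷ xs)) ys)
  double-counting-∷ x xs []       = refl
  double-counting-∷ x xs (y ∷ ys)
    with does (R? x y)
       | trans (x∙yz≈y∙xz ℕ.+-commutativeSemigroup (row x ys) (column xs y) (sum (List.map (column xs) ys)))
               (cong (column xs y +_) (double-counting-∷ x xs ys))
  ... | true  | eq = cong suc eq
  ... | false | eq = eq

  double-counting : ∀ xs ys →
    sum (List.map (λ x → length (filter (R? x) ys)) xs)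
      ≡ sum (List.map (λ y → length (filter (λ x → R? x y) xs)) ys)
  double-counting []       ys =
    sym (trans (sum-map-constant (column []) 0 ys (λ _ → refl)) (ℕ.*-zeroʳ (length ys)))
  double-counting (x ∷ xs) ys =
    trans (cong (row x ys +_) (double-counting xs ys)) (double-counting-∷ x xs ys)

-- Without repetitions, equal membership means equal multiplicities. This compares a filtered
-- enumeration with a structured one without matching the orders of their elements.
unique∧⇔⇒↭ : {xs ys : List A} → List.Unique xs → List.Unique ys →
  (∀ {x} → x ∈ xs → x ∈ ys) → (∀ {x} → x ∈ ys → x ∈ xs) → xs ↭ ys
unique∧⇔⇒↭ xs! ys! xs⊆ys ys⊆xs = ∼bag⇒↭ (unique∧set⇒bag xs! ys! (mk⇔ xs⊆ys ys⊆xs))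

-- Enumerations of words and permutations.

∈-words : (w : Word n k) → w ∈ words n k
∈-words []      = here refl
∈-words (x ∷ w) = ∈-cartesianProductWith⁺ _∷_ (∈-allFin x) (∈-words w)

words! : ∀ n k → List.Unique (words n k)
words! n zero    = ListAll.[] ∷ []
words! n (suc k) = List.cartesianProductWith⁺ _∷_ ∷-injective (List.allFin⁺ n) (words! n k)

S! : ∀ n → List.Unique (S n)
S! n = List.filter⁺ isPermutation? (words! n n)

length-filter≡0⇒∉ : {P : Pred A p} (P? : Decidable P) {xs : List A} →
  length (filter P? xs) ≡ 0 → ∀ {x} → x ∈ xs → ¬ P x
length-filter≡0⇒∉ P? {xs} len≡0 x∈xs px with filter P? xs | ∈-filter⁺ P? x∈xs px
... | _ ∷ _ | _ with () ← len≡0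

¬occurrence : (q : Word k k) (σ : Word n n) → Avoids q σ → ∀ is → ¬ IsOccurrence q σ is
¬occurrence q σ avoids is = length-filter≡0⇒∉ (isOccurrence? q σ) avoids (∈-words is)

¬occurrence⇒avoids : (q : Word k k) (σ : Word n n) → (∀ is → ¬ IsOccurrence q σ is) → Avoids q σ
¬occurrence⇒avoids q σ none =
  cong length (filter-none (isOccurrence? q σ) (ListAll.universal none (words _ _)))

-- Increasing words

-- Inductive form of `Increasing`: positions are scanned from 0 upwards, each being kept or skipped.
-- The two choices are the two terms of Pascal's rule and drive the induction in `count-prescribed`.
data Inc : Word n k → Set where
  []   : Inc {n = zero} []
  keep : {w : Word n k} → Inc w → Inc (zero ∷ Vec.map suc w)
  skip : {w : Word n k} → Inc w → Inc (Vec.map suc w)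

Inc⇒≤ : {w : Word n k} → Inc w → k ≤ n
Inc⇒≤ []        = z≤n
Inc⇒≤ (keep iw) = s≤s (Inc⇒≤ iw)
Inc⇒≤ (skip iw) = ℕ.m≤n⇒m≤1+n (Inc⇒≤ iw)

Inc⇒Increasing : {w : Word n k} → Inc w → Increasing w
Inc⇒Increasing (keep {w = w} iw) zero (suc l) _ =
  subst (zero {0} <_) (sym (lookup-map l suc w)) z<s
Inc⇒Increasing (keep {w = w} iw) (suc j) (suc l) j<l =
  subst₂ _<_ (sym (lookup-map j suc w)) (sym (lookup-map l suc w))
    (s<s (Inc⇒Increasing iw j l (s<s⁻¹ j<l)))
Inc⇒Increasing (skip {w = w} iw) j l j<l =
  subst₂ _<_ (sym (lookup-map j suc w)) (sym (lookup-map l suc w))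
    (s<s (Inc⇒Increasing iw j l j<l))

positive⇒map-suc : (w : Word (suc n) k) → (∀ j → zero {n} < lookup w j) → ∃ λ v → w ≡ Vec.map suc v
positive⇒map-suc []          _   = [] , refl
positive⇒map-suc (zero ∷ w)  pos with () ← pos zero
positive⇒map-suc (suc x ∷ w) pos with v , refl ← positive⇒map-suc w (pos ∘ suc) = x ∷ v , refl

Increasing-map-suc⁻ : (w : Word n k) → Increasing (Vec.map suc w) → Increasing w
Increasing-map-suc⁻ w inc j l j<l =
  s<s⁻¹ (subst₂ _<_ (lookup-map j suc w) (lookup-map l suc w) (inc j l j<l))

Increasing⇒Inc : (w : Word n k) → Increasing w → Inc w
Increasing⇒Inc {zero}  []         _   = []
Increasing⇒Inc {suc n} []         _   = skip (Increasing⇒Inc [] λ ())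
Increasing⇒Inc {suc n} (zero ∷ w) inc
  with v , refl ← positive⇒map-suc w (λ j → inc zero (suc j) z<s) =
  keep (Increasing⇒Inc v (Increasing-map-suc⁻ v (λ j l j<l → inc (suc j) (suc l) (s<s j<l))))
Increasing⇒Inc {suc n} w@(suc x ∷ _) inc
  with v , w≡ ← positive⇒map-suc w (λ { zero → z<s ; (suc j) → ℕ.<-trans z<s (inc zero (suc j) z<s) }) =
  subst Inc (sym w≡) (skip (Increasing⇒Inc v (Increasing-map-suc⁻ v (subst Increasing w≡ inc))))

Inc-tail : {w : Word n (suc k)} → Inc w → Inc (tail w)
Inc-tail (keep iw)             = skip iw
Inc-tail (skip {w = _ ∷ _} iw) = skip (Inc-tail iw)

-- Only the first entry can be position 0. The others can be shifted down to index a sign vector,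
-- which has no sign for position 0.
Inc-tail-map-suc : {w : Word (suc n) (suc k)} → Inc w → ∃ λ v → Inc v × tail w ≡ Vec.map suc v
Inc-tail-map-suc (keep iw)             = _ , iw , refl
Inc-tail-map-suc (skip {w = _ ∷ _} iw) = _ , Inc-tail iw , refl

increasing : ∀ n k → List (Word n k)
increasing n       zero    = List.[ [] ]
increasing zero    (suc k) = []
increasing (suc n) (suc k) =
  List.map (λ w → zero ∷ Vec.map suc w) (increasing n k) ++ List.map (Vec.map suc) (increasing n (suc k))

length-increasing : ∀ n k → length (increasing n k) ≡ n C k
length-increasing n       zero    = refl
length-increasing zero    (suc k) = refl
length-increasing (suc n) (suc k) = begin
  length (xs ++ ys)
    ≡⟨ length-++ xs ⟩
  length xs + length ys
    ≡⟨ cong₂ _+_ (length-map _ (increasing n k)) (length-map _ (increasing n (suc k))) ⟩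
  length (increasing n k) + length (increasing n (suc k))
    ≡⟨ cong₂ _+_ (length-increasing n k) (length-increasing n (suc k)) ⟩
  n C k + n C suc k
    ≡⟨ nCk+nC[k+1]≡[n+1]C[k+1] n k ⟩
  suc n C suc k ∎
  where
  open ≡-Reasoning
  xs = List.map (λ w → zero ∷ Vec.map suc w) (increasing n k)
  ys = List.map (Vec.map suc) (increasing n (suc k))

map-injective : {g : A → B} → (∀ {x y} → g x ≡ g y → x ≡ y) →
  {xs ys : Vec A n} → Vec.map g xs ≡ Vec.map g ys → xs ≡ ys
map-injective inj {[]}     {[]}     _  = refl
map-injective inj {_ ∷ _} {_ ∷ _} eq =
  cong₂ _∷_ (inj (∷-injectiveˡ eq)) (map-injective inj (∷-injectiveʳ eq))

increasing! : ∀ n k → List.Unique (increasing n k)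
increasing! n       zero    = ListAll.[] ∷ []
increasing! zero    (suc k) = []
increasing! (suc n) (suc k) = List.++⁺
  (List.map⁺ (map-injective suc-injective ∘ ∷-injectiveʳ) (increasing! n k))
  (List.map⁺ (map-injective suc-injective) (increasing! n (suc k)))
  λ (x∈ , y∈) → disjoint (∈-map⁻ _ x∈) (∈-map⁻ _ y∈)
  where
  disjoint : {w : Word (suc n) (suc k)} →
    ∃ (λ u → u ∈ increasing n k × w ≡ zero ∷ Vec.map suc u) →
    ¬ ∃ (λ v → v ∈ increasing n (suc k) × w ≡ Vec.map suc v)
  disjoint (_ , _ , refl) (_ ∷ _ , _ , ())

∈-increasing⁺ : {w : Word n k} → Inc w → w ∈ increasing n k
∈-increasing⁺ {k = zero} _ = here (empty _)
  where
  empty : (w : Word n zero) → w ≡ []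
  empty [] = refl
∈-increasing⁺ {k = suc k} (keep iw) = ∈-++⁺ˡ (∈-map⁺ _ (∈-increasing⁺ iw))
∈-increasing⁺ {n = suc n} {k = suc k} (skip iw) =
  ∈-++⁺ʳ (List.map _ (increasing n k)) (∈-map⁺ _ (∈-increasing⁺ iw))

∈-increasing⁻ : {w : Word n k} → w ∈ increasing n k → Inc w
∈-increasing⁻ {k = zero} {w = []} _ = Increasing⇒Inc [] λ ()
∈-increasing⁻ {n = suc n} {k = suc k} w∈
  with ∈-++⁻ (List.map _ (increasing n k)) w∈
... | inj₁ w∈ˡ with _ , v∈ , refl ← ∈-map⁻ _ w∈ˡ = keep (∈-increasing⁻ v∈)
... | inj₂ w∈ʳ with _ , v∈ , refl ← ∈-map⁻ _ w∈ʳ = skip (∈-increasing⁻ v∈)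

-- Sign vectors

signs : ∀ n → List (Vec Bool n)
signs zero    = List.[ [] ]
signs (suc n) = List.map (true ∷_) (signs n) ++ List.map (false ∷_) (signs n)

∈-signs : (s : Vec Bool n) → s ∈ signs n
∈-signs []          = here refl
∈-signs (true  ∷ s) = ∈-++⁺ˡ (∈-map⁺ _ (∈-signs s))
∈-signs (false ∷ s) = ∈-++⁺ʳ (List.map _ (signs _)) (∈-map⁺ _ (∈-signs s))

signs! : ∀ n → List.Unique (signs n)
signs! zero    = ListAll.[] ∷ []
signs! (suc n) = List.++⁺
  (List.map⁺ ∷-injectiveʳ (signs! n))
  (List.map⁺ ∷-injectiveʳ (signs! n))
  λ (x∈ , y∈) → disjoint (∈-map⁻ _ x∈) (∈-map⁻ _ y∈)
  where
  disjoint : {s : Vec Bool (suc n)} →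
    ∃ (λ t → t ∈ signs n × s ≡ true ∷ t) → ¬ ∃ (λ t → t ∈ signs n × s ≡ false ∷ t)
  disjoint (_ , _ , refl) (_ , _ , ())

length-filter-signs : {P : Pred (Vec Bool (suc n)) p} (P? : Decidable P) →
  length (filter P? (signs (suc n)))
    ≡ length (filter (P? ∘ (true ∷_)) (signs n)) + length (filter (P? ∘ (false ∷_)) (signs n))
length-filter-signs {n = n} P? = begin
  length (filter P? (xs ++ ys))
    ≡⟨ cong length (filter-++ P? xs ys) ⟩
  length (filter P? xs ++ filter P? ys)
    ≡⟨ length-++ (filter P? xs) ⟩
  length (filter P? xs) + length (filter P? ys)
    ≡⟨ cong₂ _+_ (length-filter-map P? _ (signs n)) (length-filter-map P? _ (signs n)) ⟩
  length (filter (P? ∘ (true ∷_)) (signs n)) + length (filter (P? ∘ (false ∷_)) (signs n)) ∎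
  where
  open ≡-Reasoning
  xs = List.map (true ∷_) (signs n)
  ys = List.map (false ∷_) (signs n)

selects? : (w : Word m k) (t : Vec Bool k) → Decidable (λ s → Vec.map (lookup s) w ≡ t)
selects? w t s = ≡-dec Bool._≟_ (Vec.map (lookup s) w) t

-- The bound matters because `∸` truncates: for `k` above `m` the left side is 2 and the right side
-- is 1.
2^-+ : k ≤ m → 2 ^ (m ∸ k) + 2 ^ (m ∸ k) ≡ 2 ^ (suc m ∸ k)
2^-+ {k} {m} k≤m rewrite ℕ.+-∸-assoc 1 k≤m = cong (2 ^ (m ∸ k) +_) (sym (ℕ.+-identityʳ _))

-- Induction on the choice of positions. A kept position admits one of the two leading signs, so the
-- count is unchanged while `m` and `k` both grow; a skipped position admits both, so the count
-- doubles.
count-prescribed : {w : Word m k} → Inc w → (t : Vec Bool k) →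
  length (filter (selects? w t) (signs m)) ≡ 2 ^ (m ∸ k)
count-prescribed [] [] = refl
count-prescribed {suc m} {suc k} (keep {w = w} iw) (b ∷ t) =
  trans (length-filter-signs (selects? w⁺ (b ∷ t))) (split b)
  where
  w⁺ = zero ∷ Vec.map suc w
  matching : ∀ c → length (filter (selects? w⁺ (c ∷ t) ∘ (c ∷_)) (signs m)) ≡ 2 ^ (m ∸ k)
  matching c = trans
    (cong length (filter-≐ (selects? w⁺ (c ∷ t) ∘ (c ∷_)) (selects? w t)
      ( (λ {s} eq → trans (map-∘ (lookup (c ∷ s)) suc w) (∷-injectiveʳ eq))
      , (λ {s} eq → cong (c ∷_) (trans (sym (map-∘ (lookup (c ∷ s)) suc w)) eq)) ) (signs m)))
    (count-prescribed iw t)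
  mismatching : ∀ c d → c ≢ d → length (filter (selects? w⁺ (d ∷ t) ∘ (c ∷_)) (signs m)) ≡ 0
  mismatching c d c≢d = cong length
    (filter-none (selects? w⁺ (d ∷ t) ∘ (c ∷_)) (ListAll.universal (λ _ → c≢d ∘ ∷-injectiveˡ) (signs m)))
  split : ∀ b →
    length (filter (selects? w⁺ (b ∷ t) ∘ (true ∷_)) (signs m))
      + length (filter (selects? w⁺ (b ∷ t) ∘ (false ∷_)) (signs m)) ≡ 2 ^ (m ∸ k)
  split true  = trans (cong₂ _+_ (matching true) (mismatching false true λ ())) (ℕ.+-identityʳ _)
  split false = cong₂ _+_ (mismatching true false λ ()) (matching false)
count-prescribed {suc m} {k} (skip {w = w} iw) t =
  trans (length-filter-signs (selects? w⁺ t))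
    (trans (cong₂ _+_ (shifted true) (shifted false)) (2^-+ (Inc⇒≤ iw)))
  where
  w⁺ = Vec.map suc w
  shifted : ∀ c → length (filter (selects? w⁺ t ∘ (c ∷_)) (signs m)) ≡ 2 ^ (m ∸ k)
  shifted c = trans
    (cong length (filter-≐ (selects? w⁺ t ∘ (c ∷_)) (selects? w t)
      ( (λ {s} eq → trans (map-∘ (lookup (c ∷ s)) suc w) eq)
      , (λ {s} eq → trans (sym (map-∘ (lookup (c ∷ s)) suc w)) eq) ) (signs m)))
    (count-prescribed iw t)

-- Permutations from sign vectors

punchIn-mono-< : (v : Fin (suc n)) {x y : Fin n} → x < y → punchIn v x < punchIn v y
punchIn-mono-< v {x} {y} x<y = ℕ.≰⇒> (ℕ.<⇒≱ x<y ∘ punchIn-cancel-≤ v y x)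

punchIn-above : (v : Fin (suc n)) (x : Fin n) → toℕ v ≤ toℕ x → v < punchIn v x
punchIn-above zero    x       _   = z<s
punchIn-above (suc v) (suc x) v≤x = s<s (punchIn-above v x (s≤s⁻¹ v≤x))

punchIn-below : (v : Fin (suc n)) (x : Fin n) → suc (toℕ x) ≤ toℕ v → punchIn v x < v
punchIn-below (suc v) zero    _   = z<s
punchIn-below (suc v) (suc x) x<v = s<s (punchIn-below v x (s≤s⁻¹ x<v))

-- Convention: `x` is the earlier entry and `y` the later one, so `true` records that the later
-- entry is the larger.
Side : Bool → Fin n → Fin n → Set
Side true  x y = x < y
Side false x y = y < x

side-⇔ : ∀ b {x y : Fin n} {x′ y′ : Fin m} → Side b x y → Side b x′ y′ → (x < y) ⇔ (x′ < y′)
side-⇔ true  xy xy′ = mk⇔ (λ _ → xy′) (λ _ → xy)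
side-⇔ false yx yx′ =
  mk⇔ (λ xy → contradiction xy (ℕ.<-asym yx)) (λ xy′ → contradiction xy′ (ℕ.<-asym yx′))

side-⇔-flip : ∀ b {x y : Fin n} {x′ y′ : Fin m} → Side b x y → Side b x′ y′ → (y < x) ⇔ (y′ < x′)
side-⇔-flip true  xy xy′ = side-⇔ false xy xy′
side-⇔-flip false yx yx′ = side-⇔ true yx yx′

side-unique : ∀ b c {x y : Fin n} {x′ y′ : Fin m} →
  Side b x y → Side c x′ y′ → (x < y) ⇔ (x′ < y′) → b ≡ c
side-unique true  true  _  _   _ = refl
side-unique false false _  _   _ = refl
side-unique true  false xy yx′ e = contradiction yx′ (ℕ.<-asym (to e xy))
side-unique false true  yx xy′ e = contradiction yx (ℕ.<-asym (from e xy′))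

-- The value of a new first entry next to the old first value `x`. With `true` it takes the value
-- `x`, and `punchIn` moves the old entry to one above; with `false` it takes one more than `x`, and
-- the old entry stays below.
adjacent : Bool → Fin n → Fin (suc n)
adjacent true  = inject₁
adjacent false = suc

adjacent-lower : ∀ b (x : Fin n) → toℕ x ≤ toℕ (adjacent b x)
adjacent-lower true  x = ℕ.≤-reflexive (sym (toℕ-inject₁ x))
adjacent-lower false x = ℕ.n≤1+n (toℕ x)

adjacent-upper : ∀ b (x : Fin n) → toℕ (adjacent b x) ≤ suc (toℕ x)
adjacent-upper true  x = ℕ.m≤n⇒m≤1+n (ℕ.≤-reflexive (toℕ-inject₁ x))
adjacent-upper false x = ℕ.≤-refl

adjacent-side : ∀ b (x : Fin n) → Side b (adjacent b x) (punchIn (adjacent b x) x)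
adjacent-side true  x = punchIn-above (inject₁ x) x (ℕ.≤-reflexive (toℕ-inject₁ x))
adjacent-side false x = punchIn-below (suc x) x ℕ.≤-refl

-- No other value lies between the new first value and the old one, so every other entry is on the
-- same side of both.
adjacent-preserves-side : ∀ b c {x y : Fin n} →
  Side c x y → Side c (adjacent b x) (punchIn (adjacent b x) y)
adjacent-preserves-side b true  {x} {y} x<y =
  punchIn-above (adjacent b x) y (ℕ.≤-trans (adjacent-upper b x) x<y)
adjacent-preserves-side b false {x} {y} y<x =
  punchIn-below (adjacent b x) y (ℕ.≤-trans y<x (adjacent-lower b x))

insertFirst : Fin (suc n) → Word n k → Word (suc n) (suc k)
insertFirst v τ = v ∷ Vec.map (punchIn v) τ

fromSigns : Vec Bool m → Word (suc m) (suc m)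
fromSigns []      = zero ∷ []
fromSigns (b ∷ s) = insertFirst (adjacent b (lookup (fromSigns s) zero)) (fromSigns s)

-- Prepending a dummy sign d for position 0, which is never read since i < j, aligns the
-- indices of signs and positions.
fromSigns-side : (s : Vec Bool m) (d : Bool) {i j : Fin (suc m)} → i < j →
  Side (lookup (d ∷ s) j) (lookup (fromSigns s) i) (lookup (fromSigns s) j)
fromSigns-side []      d {zero} {zero} ()
fromSigns-side (b ∷ s) d {zero} {suc zero} _ =
  subst (Side b _) (sym (lookup-map zero _ (fromSigns s)))
    (adjacent-side b (lookup (fromSigns s) zero))
-- From the third entry on, the sign is already realised relative to the old first entry, and the
-- new first entry is adjacent to that one.
fromSigns-side (b ∷ s) d {zero} {suc (suc j)} _ =
  subst (Side (lookup s j) _) (sym (lookup-map (suc j) _ (fromSigns s)))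
    (adjacent-preserves-side b (lookup s j) (fromSigns-side s d {zero} {suc j} z<s))
fromSigns-side (b ∷ s) d {suc i} {suc j} i<j
  rewrite lookup-map i (punchIn (adjacent b (lookup (fromSigns s) zero))) (fromSigns s)
        | lookup-map j (punchIn (adjacent b (lookup (fromSigns s) zero))) (fromSigns s) =
  punchIn-side _ (lookup (b ∷ s) j) (fromSigns-side s b (s<s⁻¹ i<j))
  where
  punchIn-side : (v : Fin (suc n)) (c : Bool) {x y : Fin n} → Side c x y → Side c (punchIn v x) (punchIn v y)
  punchIn-side v true  = punchIn-mono-< v
  punchIn-side v false = punchIn-mono-< v

-- Supplies the position of a prescribed value in `noneBetween⇒adjacent`. A value other than the
-- first is found by undoing the shift and searching the shorter word.
fromSigns-surjective : (s : Vec Bool m) (x : Fin (suc m)) → ∃ λ i → lookup (fromSigns s) i ≡ x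
fromSigns-surjective []      zero = zero , refl
fromSigns-surjective (b ∷ s) x    with adjacent b (lookup (fromSigns s) zero) Fin.≟ x
... | yes v≡x = zero , v≡x
... | no  v≢x with i , eq ← fromSigns-surjective s (punchOut v≢x) =
  suc i , trans (lookup-map i _ (fromSigns s)) (trans (cong (punchIn _) eq) (punchIn-punchOut v≢x))

fromSigns! : (s : Vec Bool m) → Unique (fromSigns s)
fromSigns! []      = [] ∷ []
fromSigns! (b ∷ s) =
  All.map⁺ (All.universal (λ x → punchInᵢ≢i _ x ∘ sym) (fromSigns s)) ∷
  Unique.map⁺ (punchIn-injective _ _ _) (fromSigns! s)

lookup-ext : {xs ys : Vec A n} → (∀ i → lookup xs i ≡ lookup ys i) → xs ≡ ys
lookup-ext {xs = xs} {ys} eq =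
  trans (sym (tabulate∘lookup xs)) (trans (tabulate-cong eq) (tabulate∘lookup ys))

-- Each sign can be read off from the word by comparing the entry at its position with the first
-- entry.
fromSigns-injective : (s t : Vec Bool m) → fromSigns s ≡ fromSigns t → s ≡ t
fromSigns-injective s t eq = lookup-ext λ j → side-unique _ _
  (fromSigns-side s true {zero} {suc j} z<s)
  (fromSigns-side t true {zero} {suc j} z<s)
  (subst (λ σ → (lookup (fromSigns s) zero < lookup (fromSigns s) (suc j))
              ⇔ (lookup σ zero < lookup σ (suc j)))
    eq (mk⇔ (λ z → z) (λ z → z)))

-- Occurrences of patterns

-- The side of an entry relative to an earlier one depends only on the later position, so a chosen
-- subword inherits the signs at its positions. The outer `true` is the dummy for the first entry of
-- the subword, the inner one for position 0.
selected⇒side : (s : Vec Bool m) (is : Word (suc m) (suc k)) → Increasing is → ∀ {j l} → j < l →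
  Side (lookup (true ∷ Vec.map (lookup (true ∷ s)) (tail is)) l)
    (lookup (fromSigns s) (lookup is j)) (lookup (fromSigns s) (lookup is l))
selected⇒side s is@(_ ∷ w) inc {j} {suc l} j<l
  rewrite lookup-map l (lookup (true ∷ s)) w = fromSigns-side s true (inc j (suc l) j<l)

selected⇒orderIsomorphic : (p : Vec Bool k) (s : Vec Bool m) (is : Word (suc m) (suc k)) → Increasing is →
  Vec.map (lookup (true ∷ s)) (tail is) ≡ p → OrderIsomorphicAt (fromSigns p) (fromSigns s) is
selected⇒orderIsomorphic p s is inc refl j l with <-cmp j l
... | tri< j<l _ _  = side-⇔ _ (fromSigns-side p true j<l) (selected⇒side s is inc j<l)
... | tri≈ _ refl _ =
  mk⇔ (λ j<j → contradiction j<j (<-irrefl refl)) (λ j<j → contradiction j<j (<-irrefl refl))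
... | tri> _ _ l<j  = side-⇔-flip _ (fromSigns-side p true l<j) (selected⇒side s is inc l<j)

-- Comparing the first entry with each later one already determines all the signs.
orderIsomorphic⇒selected : (p : Vec Bool k) (s : Vec Bool m) (is : Word (suc m) (suc k)) → Increasing is →
  OrderIsomorphicAt (fromSigns p) (fromSigns s) is → Vec.map (lookup (true ∷ s)) (tail is) ≡ p
orderIsomorphic⇒selected p s (_ ∷ w) inc iso = lookup-ext λ l →
  trans (lookup-map l (lookup (true ∷ s)) w)
    (sym (side-unique _ _
      (fromSigns-side p true {zero} {suc l} z<s)
      (fromSigns-side s true (inc zero (suc l) z<s))
      (iso zero (suc l))))

selectedTail? : (p : Vec Bool k) (s : Vec Bool m) →
  Decidable (λ (is : Word (suc m) (suc k)) → Vec.map (lookup (true ∷ s)) (tail is) ≡ p)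
selectedTail? p s is = selects? (tail is) p (true ∷ s)

-- Turns order isomorphism, a condition on all pairs of chosen entries, into an equation between
-- sign vectors, with candidates drawn from a list of binomial length.
occurrences-fromSigns : (p : Vec Bool k) (s : Vec Bool m) →
  occurrences (fromSigns p) (fromSigns s) ≡ length (filter (selectedTail? p s) (increasing (suc m) (suc k)))
occurrences-fromSigns p s = ↭-length (unique∧⇔⇒↭
  (List.filter⁺ occurs? (words! _ _))
  (List.filter⁺ (selectedTail? p s) (increasing! _ _))
  (λ {is} is∈ → let (inc , iso) = proj₂ (∈-filter⁻ occurs? {xs = words _ _} is∈) in
    ∈-filter⁺ (selectedTail? p s) (∈-increasing⁺ (Increasing⇒Inc _ inc)) (orderIsomorphic⇒selected p s is inc iso))
  (λ {is} is∈ → let (is∈inc , sel) = ∈-filter⁻ (selectedTail? p s) is∈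
                    inc = Inc⇒Increasing (∈-increasing⁻ is∈inc) in
    ∈-filter⁺ occurs? (∈-words _) (inc , selected⇒orderIsomorphic p s is inc sel)))
  where
  occurs? = isOccurrence? (fromSigns p) (fromSigns s)

-- Avoidance of 132 and 312

-- The order of i and j is left open, so that both 132 and 312 are excluded.
NoneBetween : Word n n → Set
NoneBetween σ = ∀ {i j k} → i < k → j < k → lookup σ i < lookup σ k → ¬ lookup σ k < lookup σ j

fromSigns-noneBetween : (s : Vec Bool m) → NoneBetween (fromSigns s)
fromSigns-noneBetween s {i} {j} {k} i<k j<k σi<σk σk<σj =
  excluded (lookup (true ∷ s) k) (fromSigns-side s true i<k) (fromSigns-side s true j<k)
  where
  excluded : ∀ b → Side b (lookup (fromSigns s) i) (lookup (fromSigns s) k) →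
    ¬ Side b (lookup (fromSigns s) j) (lookup (fromSigns s) k)
  excluded true  _     σj<σk = ℕ.<-asym σk<σj σj<σk
  excluded false σk<σi _     = ℕ.<-asym σi<σk σk<σi

-- The last entry of 132 lies in value between the two before it.
noneBetween⇒avoids-p132 : (σ : Word n n) → NoneBetween σ → Avoids p132 σ
noneBetween⇒avoids-p132 σ none = ¬occurrence⇒avoids p132 σ λ where
  (i ∷ j ∷ k ∷ []) (inc , iso) →
    none (inc 0F 2F z<s) (inc 1F 2F (s<s z<s)) (to (iso 0F 2F) z<s) (to (iso 2F 1F) (s<s z<s))

noneBetween⇒avoids-p312 : (σ : Word n n) → NoneBetween σ → Avoids p312 σ
noneBetween⇒avoids-p312 σ none = ¬occurrence⇒avoids p312 σ λ where
  (i ∷ j ∷ k ∷ []) (inc , iso) →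
    none (inc 1F 2F (s<s z<s)) (inc 0F 2F z<s) (to (iso 1F 2F) z<s) (to (iso 2F 0F) (s<s z<s))

increasing₃ : {i j k : Fin n} → i < j → j < k → Increasing (i ∷ j ∷ k ∷ [])
increasing₃ i<j j<k 0F 1F _ = i<j
increasing₃ i<j j<k 0F 2F _ = ℕ.<-trans i<j j<k
increasing₃ i<j j<k 1F 2F _ = j<k
increasing₃ i<j j<k 1F 1F (s≤s ())
increasing₃ i<j j<k 2F 1F (s≤s ())
increasing₃ i<j j<k 2F 2F (s≤s (s≤s ()))

-- The entries of `q` are distinct, so different indices compare strictly one way, and monotonicity
-- then excludes the opposite comparison of `g`. An occurrence thus needs only the true inequalities
-- of the pattern.
strictMono⇒⇔ : (q : Word k k) → Unique q → (g : Fin k → Fin n) →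
  (∀ j l → lookup q j < lookup q l → g j < g l) → ∀ j l → (lookup q j < lookup q l) ⇔ (g j < g l)
strictMono⇒⇔ q q! g mono j l = mk⇔ (mono j l) reflects
  where
  reflects : g j < g l → lookup q j < lookup q l
  reflects gj<gl with <-cmp (lookup q j) (lookup q l)
  ... | tri< lt _ _ = lt
  ... | tri≈ _ eq _ = contradiction gj<gl (<-irrefl (cong g (Unique.lookup-injective q! j l eq)))
  ... | tri> _ _ gt = contradiction (mono l j gt) (ℕ.<-asym gj<gl)

p132-occurrence : (σ : Word n n) {i j k : Fin n} → i < j → j < k →
  lookup σ i < lookup σ k → lookup σ k < lookup σ j → IsOccurrence p132 σ (i ∷ j ∷ k ∷ [])
p132-occurrence σ {i} {j} {k} i<j j<k σi<σk σk<σj =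
  increasing₃ i<j j<k , strictMono⇒⇔ p132 (from-yes (isPermutation? p132)) (lookup σ ∘ lookup is) mono
  where
  is = i ∷ j ∷ k ∷ []
  mono : ∀ x y → lookup p132 x < lookup p132 y → lookup σ (lookup is x) < lookup σ (lookup is y)
  mono 0F 1F _ = ℕ.<-trans σi<σk σk<σj
  mono 0F 2F _ = σi<σk
  mono 2F 1F _ = σk<σj
  mono 1F 1F (s≤s (s≤s ()))
  mono 1F 2F (s≤s ())
  mono 2F 2F (s≤s ())

p312-occurrence : (σ : Word n n) {i j k : Fin n} → i < j → j < k →
  lookup σ j < lookup σ k → lookup σ k < lookup σ i → IsOccurrence p312 σ (i ∷ j ∷ k ∷ [])
p312-occurrence σ {i} {j} {k} i<j j<k σj<σk σk<σi =
  increasing₃ i<j j<k , strictMono⇒⇔ p312 (from-yes (isPermutation? p312)) (lookup σ ∘ lookup is) mono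
  where
  is = i ∷ j ∷ k ∷ []
  mono : ∀ x y → lookup p312 x < lookup p312 y → lookup σ (lookup is x) < lookup σ (lookup is y)
  mono 1F 0F _ = ℕ.<-trans σj<σk σk<σi
  mono 1F 2F _ = σj<σk
  mono 2F 0F _ = σk<σi
  mono 0F 0F (s≤s (s≤s ()))
  mono 0F 2F (s≤s ())
  mono 2F 2F (s≤s ())

-- The order of `i` and `j` decides the pattern: the smaller value first gives 132, the larger first
-- gives 312.
avoids⇒noneBetween : (σ : Word n n) → Avoids p132 σ → Avoids p312 σ → NoneBetween σ
avoids⇒noneBetween σ av132 av312 {i} {j} {k} i<k j<k σi<σk σk<σj with <-cmp i j
... | tri< i<j _ _  = ¬occurrence p132 σ av132 (i ∷ j ∷ k ∷ []) (p132-occurrence σ i<j j<k σi<σk σk<σj)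
... | tri≈ _ refl _ = ℕ.<-asym σi<σk σk<σj
... | tri> _ _ j<i  = ¬occurrence p312 σ av312 (j ∷ i ∷ k ∷ []) (p312-occurrence σ j<i i<k σi<σk σk<σj)

-- Recovering the signs of a permutation.

Unique-map⁻ : {g : A → B} {xs : Vec A n} → Unique (Vec.map g xs) → Unique xs
Unique-map⁻ {xs = []}    []           = []
Unique-map⁻ {g = g} {xs = _ ∷ _} (gx∉ ∷ gxs!) =
  All.map (λ gx≢gy → gx≢gy ∘ cong g) (All.map⁻ gx∉) ∷ Unique-map⁻ gxs!

All-≢⇒map-punchIn : {v : Fin (suc n)} (ρ : Word (suc n) k) → All (v ≢_) ρ → ∃ λ τ → ρ ≡ Vec.map (punchIn v) τ
All-≢⇒map-punchIn []      []        = [] , refl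
All-≢⇒map-punchIn (_ ∷ ρ) (v≢x ∷ v∉ρ) with τ , refl ← All-≢⇒map-punchIn ρ v∉ρ =
  punchOut v≢x ∷ τ , cong (_∷ _) (sym (punchIn-punchOut v≢x))

noneBetween-insertFirst⁻ : (v : Fin (suc n)) (τ : Word n n) → NoneBetween (insertFirst v τ) → NoneBetween τ
noneBetween-insertFirst⁻ v τ none {i} {j} {k} i<k j<k τi<τk τk<τj =
  none (s<s i<k) (s<s j<k) (lift i k τi<τk) (lift k j τk<τj)
  where
  lift : ∀ i j → lookup τ i < lookup τ j → lookup (Vec.map (punchIn v) τ) i < lookup (Vec.map (punchIn v) τ) j
  lift i j lt = subst₂ _<_ (sym (lookup-map i (punchIn v) τ)) (sym (lookup-map j (punchIn v) τ))
    (punchIn-mono-< v lt)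

lookup-map-≡ : (g : A → B) (xs : Vec A n) (i : Fin n) {y : A} →
  lookup xs i ≡ y → lookup (Vec.map g xs) i ≡ g y
lookup-map-≡ g xs i eq = trans (lookup-map i g xs) (cong g eq)

-- A value strictly between the first two entries would occur later on, between them.
noneBetween⇒adjacent : (v : Fin (suc (suc m))) (s : Vec Bool m) → NoneBetween (insertFirst v (fromSigns s)) →
  ∃ λ b → v ≡ adjacent b (lookup (fromSigns s) zero)
noneBetween⇒adjacent v s none with ℕ.<-cmp (toℕ v) (toℕ (lookup (fromSigns s) zero))
-- Equal numbers mean that `v` ends up directly below, since `punchIn v` moves the old first value
-- up by one.
... | tri≈ _ v≡x _ = true , toℕ-injective (trans v≡x (sym (toℕ-inject₁ _)))
-- The value `v′`, numerically equal to `v`, is shifted to one above `v` and stays below the shifted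
-- second entry. It is not the second entry itself, so it occurs later.
... | tri< v<x _ _ = contradiction (fromSigns-surjective s v′) λ where
    (zero , x≡v′) → ℕ.<-irrefl (sym (trans (cong toℕ x≡v′) v′≡v)) v<x
    (suc k , eq) → none {zero} {suc zero} {suc (suc k)} z<s (s<s z<s)
      (subst (v <_) (sym (at (suc k) eq)) (punchIn-above v v′ (ℕ.≤-reflexive (sym v′≡v))))
      (subst₂ _<_ (sym (at (suc k) eq)) (sym (at zero refl))
        (punchIn-mono-< v (ℕ.≤-<-trans (ℕ.≤-reflexive v′≡v) v<x)))
  where
  at = lookup-map-≡ (punchIn v) (fromSigns s)
  v<1+m = ℕ.<-trans v<x (toℕ<n (lookup (fromSigns s) zero))
  v′ = fromℕ< v<1+m
  v′≡v = toℕ-fromℕ< v<1+m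
noneBetween⇒adjacent v@(suc v′) s none | tri> _ _ x<v with ℕ.<-cmp (toℕ (lookup (fromSigns s) zero)) (toℕ v′)
... | tri≈ _ x≡v′ _ = false , cong suc (sym (toℕ-injective x≡v′))
... | tri> _ _ v′<x = contradiction x<v (ℕ.≤⇒≯ v′<x)
-- The value `v′`, one below `v`, is not moved by `punchIn v` and lies strictly above the second
-- entry, so it gives the forbidden later entry.
... | tri< x<v′ _ _ = contradiction (fromSigns-surjective s v′) λ where
    (zero , x≡v′) → ℕ.<-irrefl (cong toℕ x≡v′) x<v′
    (suc k , eq) → none {suc zero} {zero} {suc (suc k)} (s<s z<s) z<s
      (subst₂ _<_ (sym (at zero refl)) (sym (at (suc k) eq)) (punchIn-mono-< v x<v′))
      (subst (_< v) (sym (at (suc k) eq)) (punchIn-below v v′ ℕ.≤-refl))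
  where
  at = lookup-map-≡ (punchIn v) (fromSigns s)

-- Induction by deleting the first entry: the rest keeps its relative order and so comes from signs
-- `s`, and adjacency of the first two values supplies the leading sign.
noneBetween⇒fromSigns : (σ : Word (suc m) (suc m)) → Unique σ → NoneBetween σ → ∃ λ s → σ ≡ fromSigns s
noneBetween⇒fromSigns {zero}  (zero ∷ []) _ _ = [] , refl
noneBetween⇒fromSigns {suc m} (v ∷ ρ) (v∉ρ ∷ ρ!) none
  with τ , refl ← All-≢⇒map-punchIn ρ v∉ρ
  with s , refl ← noneBetween⇒fromSigns τ (Unique-map⁻ ρ!) (noneBetween-insertFirst⁻ v τ none)
  with b , refl ← noneBetween⇒adjacent v s none = b ∷ s , refl

-- The avoidance class and the total count.

S[132,312]↭fromSigns : ∀ m → S[132,312] (suc m) ↭ List.map fromSigns (signs m)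
S[132,312]↭fromSigns m = unique∧⇔⇒↭
  (List.filter⁺ avoids?₂ (S! (suc m)))
  (List.map⁺ (fromSigns-injective _ _) (signs! m))
  (λ {σ} σ∈ → let (σ∈S , av132 , av312) = ∈-filter⁻ avoids?₂ {xs = S (suc m)} σ∈
                  σ! = proj₂ (∈-filter⁻ isPermutation? {xs = words (suc m) (suc m)} σ∈S)
                  (s , σ≡) = noneBetween⇒fromSigns σ σ! (avoids⇒noneBetween σ av132 av312)
    in subst (_∈ _) (sym σ≡) (∈-map⁺ fromSigns (∈-signs s)))
  (λ σ∈ → let (s , _ , σ≡) = ∈-map⁻ fromSigns σ∈ in subst (_∈ _) (sym σ≡)
    (∈-filter⁺ avoids?₂ (∈-filter⁺ isPermutation? (∈-words (fromSigns s)) (fromSigns! s))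
      ( noneBetween⇒avoids-p132 (fromSigns s) (fromSigns-noneBetween s)
      , noneBetween⇒avoids-p312 (fromSigns s) (fromSigns-noneBetween s) )))
  where
  avoids?₂ : Decidable (λ (σ : Word (suc m) (suc m)) → Avoids p132 σ × Avoids p312 σ)
  avoids?₂ σ = avoids? p132 σ ×-dec avoids? p312 σ

-- Pairs of a sign vector and a set of positions are counted in two ways. Fixing the `suc k`
-- positions prescribes `k` of the `m` signs, as the first chosen position carries no condition.
f-fromSigns : (p : Vec Bool k) (m : ℕ) → f (fromSigns p) (suc m) ≡ (suc m C suc k) * 2 ^ (m ∸ k)
f-fromSigns {k} p m = begin
  sum (List.map (occurrences (fromSigns p)) (S[132,312] (suc m)))
    ≡⟨ sum-↭ (map⁺ (occurrences (fromSigns p)) (S[132,312]↭fromSigns m)) ⟩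
  sum (List.map (occurrences (fromSigns p)) (List.map fromSigns (signs m)))
    ≡⟨ cong sum (List.map-∘ (signs m)) ⟨
  sum (List.map (λ s → occurrences (fromSigns p) (fromSigns s)) (signs m))
    ≡⟨ cong sum (map-cong (occurrences-fromSigns p) (signs m)) ⟩
  sum (List.map (λ s → length (filter (selectedTail? p s) positions)) (signs m))
    ≡⟨ double-counting (selectedTail? p) (signs m) positions ⟩
  sum (List.map (λ is → length (filter (λ s → selectedTail? p s is) (signs m))) positions)
    ≡⟨ sum-map-constant _ (2 ^ (m ∸ k)) positions (λ is∈ → count (∈-increasing⁻ is∈)) ⟩
  length positions * 2 ^ (m ∸ k)
    ≡⟨ cong (_* 2 ^ (m ∸ k)) (length-increasing (suc m) (suc k)) ⟩
  (suc m C suc k) * 2 ^ (m ∸ k) ∎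
  where
  open ≡-Reasoning
  positions = increasing (suc m) (suc k)
  count : ∀ {is} → Inc is → length (filter (λ s → selectedTail? p s is) (signs m)) ≡ 2 ^ (m ∸ k)
  -- The positions after the first chosen one avoid position 0, so the dummy sign is never read and
  -- `count-prescribed` applies to `v`.
  count {is} iis with v , iv , tail≡ ← Inc-tail-map-suc iis = trans
    (cong length (filter-≐ (λ s → selectedTail? p s is) (selects? v p)
      ( (λ {s} eq → trans (sym (drop-sign s)) eq)
      , (λ {s} eq → trans (drop-sign s) eq) ) (signs m)))
    (count-prescribed iv p)
    where
    drop-sign : ∀ s → Vec.map (lookup (true ∷ s)) (tail is) ≡ Vec.map (lookup s) v
    drop-sign s = trans (cong (Vec.map (lookup (true ∷ s))) tail≡) (sym (map-∘ (lookup (true ∷ s)) suc v))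

theorem2p14 : (n : ℕ) → 3 ≤ n →
    (f p123 n ≡ f p321 n × f p321 n ≡ (n C 3) * 2 ^ (n ∸ 3)) ×
    (f p213 n ≡ f p231 n × f p231 n ≡ (n C 3) * 2 ^ (n ∸ 3))
theorem2p14 (suc m) _ =
  -- By computation, 123, 321, 213 and 231 are `fromSigns` of the sign pairs `true true`,
  -- `false false`, `false true` and `true false`, and `suc m ∸ 3` is `m ∸ 2`.
  (trans (total true true) (sym (total false false)) , total false false) ,
  (trans (total false true) (sym (total true false)) , total true false)
  where
  total : ∀ a b → f (fromSigns (a ∷ b ∷ [])) (suc m) ≡ (suc m C 3) * 2 ^ (m ∸ 2)
  total a b = f-fromSigns (a ∷ b ∷ []) m
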